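{- Let $\mathcal{K}_1,\mathcal{K}_2\subseteq\mathcal{L}$ be fuzzy languages over $E$. Then: 1) If $\mathcal{K}_1$ and $\mathcal{K}_2$ are observable, then so is $\mathcal{K}_1\cap\mathcal{K}_2$. 2) If $\mathcal{K}_1$ and $\mathcal{K}_2$ are strongly observable, then so is $\mathcal{K}_1\cap\mathcal{K}_2$. Here (strong) observability is with respect to $\mathcal{L}$, $P$, and $E_c$.
   Context: $E$ is a finite set of events and $E^*$ is the set of all finite strings over $E$, including the empty string $\epsilon$. On $[0,1]$, $\wedge$ denotes infimum (minimum). A fuzzy subset of a set $X$ is a function $X\to[0,1]$; $\mathcal{A}\subseteq\mathcal{B}$ means $\mathcal{A}(x)\le\mathcal{B}(x)$ for all $x$; $\mathrm{supp}(\mathcal{A})=\{x:\mathcal{A}(x)>0\}$; $(\mathcal{A}\cap\mathcal{B})(x)=\mathcal{A}(x)\wedge\mathcal{B}(x)$. A fuzzy language over $E$ is a fuzzy subset $\mathcal{A}$ of $E^*$ which is either the empty fuzzy language $\mathcal{O}$ (identically $0$), or satisfies $\mathcal{A}(\epsilon)=1$ and $\mathcal{A}(\mu)\ge\mathcal{A}(\mu\nu)$ for all $\mu,\nu\in E^*$. $\mathcal{L}$ is a fixed fuzzy language over $E$ (the behavior of the uncontrolled system). The event set is partitioned as $E=E_c\,\dot\cup\,E_{uc}$ (controllable, uncontrollable) and, independently, as $E=E_o\,\dot\cup\,E_{uo}$ (observable, unobservable). The natural projection $P:E^*\to E_o^*$ erases unobservable events: $P(\epsilon)=\epsilon$, $P(sa)=P(s)P(a)$,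 where $P(a)=a$ if $a\in E_o$ and $P(a)=\epsilon$ if $a\in E_{uo}$. A fuzzy language $\mathcal{K}\subseteq\mathcal{L}$ is observable (respectively, strongly observable) with respect to $\mathcal{L}$, $P$, and $E_c$ if for all $s,s'\in\mathrm{supp}(\mathcal{K})$ with $P(s)=P(s')$ and any $a\in E_c$ with $sa\in\mathrm{supp}(\mathcal{K})$, one has $\mathcal{K}(s'a)=\mathcal{K}(s')\wedge\mathcal{L}(s'a)\wedge x$ for some (respectively, any) $x\in\{x\in[0,1]:\mathcal{K}(sa)=\mathcal{K}(s)\wedge\mathcal{L}(sa)\wedge x\}$. -}

module Defs where

open import Data.Fin.Base using (Fin)
open import Data.Fin.Subset using (Subset; _∈_)
open import Data.Fin.Subset.Properties using (_∈?_)
open import Data.List.Base using (List; []; _++_; _∷ʳ_; filter)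
open import Data.Nat.Base using (ℕ)
open import Data.Product using (_×_; _,_; ∃-syntax; proj₁; proj₂; <_,_>)
open import Data.Rational.Base using (ℚ; 0ℚ; 1ℚ; _<_; _+_; -_)
open import Data.Rational.Properties
  using (<-cmp; <-trans; <-asym; <-dense; +-monoʳ-<; +-identityʳ; _<?_)
open import Data.Sum.Base using (_⊎_; inj₁; inj₂; [_,_]′)
open import Relation.Binary.Definitions using (tri<; tri≈; tri>)
open import Relation.Binary.PropositionalEquality using (_≡_; refl; subst)
open import Relation.Nullary using (¬_)
open import Relation.Nullary.Decidable using (from-yes)

-- Two-sided located Dedekind cuts of ℚ.
record ℝ : Set₁ where
  field
    L U           : ℚ → Set
    L-inhabited   : ∃[ q ] L q
    U-inhabited   : ∃[ q ] U q
    L-downward    : ∀ {q r} → q < r → L r → L q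
    L-open        : ∀ {q} → L q → ∃[ r ] q < r × L r
    U-upward      : ∀ {q r} → q < r → U q → U r
    U-open        : ∀ {r} → U r → ∃[ q ] q < r × U q
    disjoint      : ∀ {q} → ¬ (L q × U q)
    located       : ∀ {q r} → q < r → L q ⊎ U r

open ℝ

infix 4 _≤ᴿ_ _<ᴿ_

-- Locatedness and openness make the reverse inclusion of upper cuts follow.
_≤ᴿ_ : ℝ → ℝ → Set
x ≤ᴿ y = ∀ {q} → L x q → L y q

_<ᴿ_ : ℝ → ℝ → Set
x <ᴿ y = ∃[ q ] U x q × L y q

fromℚ : ℚ → ℝ
fromℚ p = record
  { L           = _< p
  ; U           = p <_
  ; L-inhabited = p + - 1ℚ ,
      subst (p + - 1ℚ <_) (+-identityʳ p) (+-monoʳ-< p (from-yes (- 1ℚ <? 0ℚ)))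
  ; U-inhabited = p + 1ℚ ,
      subst (_< p + 1ℚ) (+-identityʳ p) (+-monoʳ-< p (from-yes (0ℚ <? 1ℚ)))
  ; L-downward  = <-trans
  ; L-open      = λ q<p → let r , q<r , r<p = <-dense q<p in r , q<r , r<p
  ; U-upward    = λ q<r p<q → <-trans p<q q<r
  ; U-open      = λ p<r → let q , p<q , q<r = <-dense p<r in q , q<r , p<q
  ; disjoint    = λ (q<p , p<q) → <-asym q<p p<q
  ; located     = loc
  }
  where
  loc : ∀ {q r} → q < r → q < p ⊎ p < r
  loc {q} q<r with <-cmp q p
  ... | tri< q<p _ _    = inj₁ q<p
  ... | tri≈ _ refl _   = inj₂ q<r
  ... | tri> _ _ p<q    = inj₂ (<-trans p<q q<r)

minᴿ : ℝ → ℝ → ℝ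
minᴿ x y = record
  { L           = λ q → L x q × L y q
  ; U           = λ q → U x q ⊎ U y q
  ; L-inhabited = L-inh
  ; U-inhabited = let q , xq = U-inhabited x in q , inj₁ xq
  ; L-downward  = λ q<r (xr , yr) → L-downward x q<r xr , L-downward y q<r yr
  ; L-open      = L-op
  ; U-upward    = λ q<r → [ (λ u → inj₁ (U-upward x q<r u)) , (λ u → inj₂ (U-upward y q<r u)) ]′
  ; U-open      = [ (λ u → let q , q<r , v = U-open x u in q , q<r , inj₁ v)
                  , (λ u → let q , q<r , v = U-open y u in q , q<r , inj₂ v) ]′
  ; disjoint    = λ ((lx , ly) , u) → [ (λ ux → disjoint x (lx , ux)) , (λ uy → disjoint y (ly , uy)) ]′ u
  ; located     = loc
  }
  where
  L-inh : ∃[ q ] L x q × L y q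
  L-inh with L-inhabited x | L-inhabited y
  ... | q , xq | r , yr with <-cmp q r
  ...   | tri< q<r _ _  = q , xq , L-downward y q<r yr
  ...   | tri≈ _ refl _ = q , xq , yr
  ...   | tri> _ _ r<q  = r , L-downward x r<q xq , yr

  L-op : ∀ {q} → L x q × L y q → ∃[ r ] q < r × L x r × L y r
  L-op (xq , yq) with L-open x xq | L-open y yq
  ... | r , q<r , xr | s , q<s , ys with <-cmp r s
  ...   | tri< r<s _ _  = r , q<r , xr , L-downward y r<s ys
  ...   | tri≈ _ refl _ = r , q<r , xr , ys
  ...   | tri> _ _ s<r  = s , q<s , L-downward x s<r xr , ys

  loc : ∀ {q r} → q < r → (L x q × L y q) ⊎ (U x r ⊎ U y r)
  loc q<r with located x q<r | located y q<r
  ... | inj₁ xq | inj₁ yq = inj₁ (xq , yq)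
  ... | inj₂ xr | _       = inj₂ (inj₁ xr)
  ... | inj₁ _  | inj₂ yr = inj₂ (inj₂ yr)

record 𝕀 : Set₁ where
  constructor mk𝕀
  field
    value : ℝ
    0≤    : fromℚ 0ℚ ≤ᴿ value
    ≤1    : value ≤ᴿ fromℚ 1ℚ

open 𝕀

infix  4 _≤_ _≃_
infixr 7 _∧_

_≤_ : 𝕀 → 𝕀 → Set
x ≤ y = value x ≤ᴿ value y

-- Distinct families L, U may present the same cut, so equality of reals is
-- the equivalence below rather than _≡_.
_≃_ : 𝕀 → 𝕀 → Set
x ≃ y = x ≤ y × y ≤ x

0𝕀 1𝕀 : 𝕀
0𝕀 = mk𝕀 (fromℚ 0ℚ) (λ l → l) (λ q<0 → <-trans q<0 (from-yes (0ℚ <? 1ℚ)))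
1𝕀 = mk𝕀 (fromℚ 1ℚ) (λ q<0 → <-trans q<0 (from-yes (0ℚ <? 1ℚ))) (λ l → l)

_∧_ : 𝕀 → 𝕀 → 𝕀
x ∧ y = mk𝕀 (minᴿ (value x) (value y)) < 0≤ x , 0≤ y > (λ (l , _) → ≤1 x l)

FuzzySubset : Set → Set₁
FuzzySubset X = X → 𝕀

infix  4 _⊆_ _∈supp_
infixr 7 _∩_ _∩ᴸ_

_⊆_ : {X : Set} → FuzzySubset X → FuzzySubset X → Set
A ⊆ B = ∀ x → A x ≤ B x

_∈supp_ : {X : Set} → X → FuzzySubset X → Set
x ∈supp A = value 0𝕀 <ᴿ value (A x)

_∩_ : {X : Set} → FuzzySubset X → FuzzySubset X → FuzzySubset X
(A ∩ B) x = A x ∧ B x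

IsFuzzyLanguage : {E : Set} → FuzzySubset (List E) → Set
IsFuzzyLanguage A =
  (∀ μ → A μ ≃ 0𝕀) ⊎ (A [] ≃ 1𝕀 × (∀ μ ν → A (μ ++ ν) ≤ A μ))

record FuzzyLanguage (E : Set) : Set₁ where
  field
    ⟦_⟧        : FuzzySubset (List E)
    isLanguage : IsFuzzyLanguage ⟦_⟧

open FuzzyLanguage public

_∩ᴸ_ : {E : Set} → FuzzyLanguage E → FuzzyLanguage E → FuzzyLanguage E
K₁ ∩ᴸ K₂ = record { ⟦_⟧ = A ∩ B ; isLanguage = closed (isLanguage K₁) (isLanguage K₂) }
  where
  A = ⟦ K₁ ⟧
  B = ⟦ K₂ ⟧

  closed : IsFuzzyLanguage A → IsFuzzyLanguage B → IsFuzzyLanguage (A ∩ B)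
  closed (inj₁ A≃0) _ =
    inj₁ λ μ → (λ (a , _) → proj₁ (A≃0 μ) a) , 0≤ (A μ ∧ B μ)
  closed (inj₂ _) (inj₁ B≃0) =
    inj₁ λ μ → (λ (_ , b) → proj₁ (B≃0 μ) b) , 0≤ (A μ ∧ B μ)
  closed (inj₂ (Aε , A↓)) (inj₂ (Bε , B↓)) =
    inj₂ ( ((λ (a , _) → proj₁ Aε a) , < proj₂ Aε , proj₂ Bε >)
         , λ μ ν (a , b) → A↓ μ ν a , B↓ μ ν b )

∩ᴸ-⊆ : {E : Set} (K₁ K₂ 𝓛 : FuzzyLanguage E) →
       ⟦ K₁ ⟧ ⊆ ⟦ 𝓛 ⟧ → ⟦ K₁ ∩ᴸ K₂ ⟧ ⊆ ⟦ 𝓛 ⟧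
∩ᴸ-⊆ K₁ K₂ 𝓛 K₁⊆𝓛 s (l , _) = K₁⊆𝓛 s l

-- The event set is Fin n.  The subsets Eₒ and E_c determine
-- the two partitions; the unobservable and uncontrollable events are their
-- complements.  The codomain Eₒ* of the projection is regarded as a subset
-- of E*.
P : ∀ {n} → Subset n → List (Fin n) → List (Fin n)
P Eₒ = filter (_∈? Eₒ)

module _ {n : ℕ} (𝓛 : FuzzyLanguage (Fin n)) (Eₒ E_c : Subset n) where

  Observable : FuzzyLanguage (Fin n) → Set₁
  Observable K =
    ∀ s s′ → s ∈supp ⟦ K ⟧ → s′ ∈supp ⟦ K ⟧ → P Eₒ s ≡ P Eₒ s′ →
    ∀ a → a ∈ E_c → (s ∷ʳ a) ∈supp ⟦ K ⟧ →
    ∃[ x ] ⟦ K ⟧ (s ∷ʳ a)  ≃ ⟦ K ⟧ s  ∧ ⟦ 𝓛 ⟧ (s ∷ʳ a)  ∧ x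
         × ⟦ K ⟧ (s′ ∷ʳ a) ≃ ⟦ K ⟧ s′ ∧ ⟦ 𝓛 ⟧ (s′ ∷ʳ a) ∧ x

  StronglyObservable : FuzzyLanguage (Fin n) → Set₁
  StronglyObservable K =
    ∀ s s′ → s ∈supp ⟦ K ⟧ → s′ ∈supp ⟦ K ⟧ → P Eₒ s ≡ P Eₒ s′ →
    ∀ a → a ∈ E_c → (s ∷ʳ a) ∈supp ⟦ K ⟧ →
    ∀ x → ⟦ K ⟧ (s ∷ʳ a)  ≃ ⟦ K ⟧ s  ∧ ⟦ 𝓛 ⟧ (s ∷ʳ a)  ∧ x
        → ⟦ K ⟧ (s′ ∷ʳ a) ≃ ⟦ K ⟧ s′ ∧ ⟦ 𝓛 ⟧ (s′ ∷ʳ a) ∧ x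

{-# OPTIONS --safe #-}
-- Observability: if x₁ and x₂ are witnesses for K₁ and K₂, then x₁ ∧ x₂ is one
-- for K₁ ∩ K₂.
--
-- Strong observability: write aᵢ = Kᵢ(s), bᵢ = Kᵢ(sa), l = 𝓛(sa), and suppose
-- b₁ ∧ b₂ = a₁ ∧ a₂ ∧ l ∧ x.  In a chain this forces, for some i, that bᵢ is the
-- smaller of b₁, b₂ and bᵢ = aᵢ ∧ l ∧ x, so that x is an admissible value for Kᵢ.
-- For the other index j the value bⱼ itself is admissible, and it imposes no
-- further restriction at s′ because Kᵢ(s′a) ≤ bᵢ ≤ bⱼ.  The order on ℝ is not
-- decidable, but the conclusion is ¬¬-stable, so it may be proved by
-- comparing reals.
module Submission where

open import Defs
open import Data.Nat.Base using (ℕ)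
open import Data.Fin.Base using (Fin)
open import Data.Fin.Subset using (Subset)
open import Data.List.Base using (List; []; _∷_; _∷ʳ_)
open import Data.Product using (_×_; _,_; proj₁; proj₂; map₂; swap)
open import Data.Rational.Properties using (<-cmp)
open import Data.Sum.Base using (inj₁; inj₂)
open import Relation.Binary.Definitions using (tri<; tri≈; tri>)
open import Relation.Binary.PropositionalEquality using (refl)
open import Relation.Nullary using (¬_; contradiction)

open ℝ
open 𝕀

-- Openness puts some `r` above `q` still below `x`. Locating `y` between them either gives `L y q`
-- or puts `y` below `r`, which refutes `x ≤ᴿ y`.
≤ᴿ-stable : ∀ x y → ¬ ¬ (x ≤ᴿ y) → x ≤ᴿ y
≤ᴿ-stable x y ¬¬x≤y xq with L-open x xq
... | r , q<r , xr with located y q<r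
...   | inj₁ yq = yq
...   | inj₂ y<r = contradiction (λ x≤y → disjoint y (x≤y xr , y<r)) ¬¬x≤y

U⇒L⇒≤ᴿ : ∀ x y {r} → U x r → L y r → x ≤ᴿ y
U⇒L⇒≤ᴿ x y {r} x<r yr {q} xq with <-cmp q r
... | tri< q<r _ _  = L-downward y q<r yr
... | tri≈ _ refl _ = yr
... | tri> _ _ r<q  = contradiction (xq , U-upward x r<q x<r) (disjoint x)

≰ᴿ⇒≥ᴿ : ∀ x y → ¬ (x ≤ᴿ y) → y ≤ᴿ x
≰ᴿ⇒≥ᴿ x y x≰y yq with L-open y yq
... | r , q<r , yr with located x q<r
...   | inj₁ xq  = xq
...   | inj₂ x<r = contradiction (λ {_} → U⇒L⇒≤ᴿ x y x<r yr) x≰y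

≃-stable : ∀ x y → ¬ ¬ (x ≃ y) → x ≃ y
≃-stable x y ¬¬x≃y =
    ≤ᴿ-stable (value x) (value y) (λ x≰y → ¬¬x≃y (λ x≃y → x≰y (proj₁ x≃y)))
  , ≤ᴿ-stable (value y) (value x) (λ y≰x → ¬¬x≃y (λ x≃y → y≰x (proj₂ x≃y)))

-- Replaces a case split on the order of `a` and `b`: if `x ≃ y` failed, `f` would refute `a ≤ b`,
-- hence `b ≤ a`, and `g` would apply.
≃-by-comparing : ∀ a b {x y} → (a ≤ b → x ≃ y) → (b ≤ a → x ≃ y) → x ≃ y
≃-by-comparing a b {x} {y} f g = ≃-stable x y λ x≄y →
  x≄y (g (≰ᴿ⇒≥ᴿ (value a) (value b) λ a≤b → x≄y (f a≤b)))

-- Regrouping leaves two copies of `l`, which merge by idempotence.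
∧-factor : ∀ {b₁ b₂ a₁ a₂ l x₁ x₂} → b₁ ≃ a₁ ∧ l ∧ x₁ → b₂ ≃ a₂ ∧ l ∧ x₂ →
           b₁ ∧ b₂ ≃ (a₁ ∧ a₂) ∧ l ∧ (x₁ ∧ x₂)
∧-factor (f₁ , g₁) (f₂ , g₂) =
    (λ (p₁ , p₂) → let u₁ , v , w₁ = f₁ p₁ ; u₂ , _ , w₂ = f₂ p₂
                   in (u₁ , u₂) , v , (w₁ , w₂))
  , (λ ((u₁ , u₂) , v , (w₁ , w₂)) → g₁ (u₁ , v , w₁) , g₂ (u₂ , v , w₂))

∧-swap : ∀ {b₁ b₂ a₁ a₂ c} → b₁ ∧ b₂ ≃ (a₁ ∧ a₂) ∧ c → b₂ ∧ b₁ ≃ (a₂ ∧ a₁) ∧ c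
∧-swap (f , g) =
    (λ p → let u , v = f (swap p) in swap u , v)
  , (λ (u , v) → swap (g (swap u , v)))

-- The condition on a, b = K(s), K(sa) and a′, b′ = K(s′), K(s′a) in the
-- definition of strong observability, with l, l′ = 𝓛(sa), 𝓛(s′a).
Transfers : (l l′ a b a′ b′ : 𝕀) → Set₁
Transfers l l′ a b a′ b′ = ∀ x → b ≃ a ∧ l ∧ x → b′ ≃ a′ ∧ l′ ∧ x

module _ {l l′ : 𝕀} where

  transfer-least : ∀ {a₁ b₁ a₁′ b₁′ a₂ b₂ a₂′ b₂′ x} →
    b₁ ≤ a₁ ∧ l → b₂ ≤ a₂ ∧ l →
    Transfers l l′ a₁ b₁ a₁′ b₁′ → Transfers l l′ a₂ b₂ a₂′ b₂′ →
    b₁ ≤ b₂ → b₁ ≃ a₁ ∧ l ∧ x →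
    b₁′ ∧ b₂′ ≃ (a₁′ ∧ a₂′) ∧ l′ ∧ x
  transfer-least {a₁} {b₁} {a₁′} {b₁′} {a₂} {b₂} {a₂′} {b₂′} {x}
    b₁≤ b₂≤ T₁ T₂ b₁≤b₂ b₁≃ =
      (λ (p , p₂) → let u , v , w = proj₁ b₁′≃x p
                    in (u , proj₁ (proj₁ b₂′≃b₂ p₂)) , v , w)
    , (λ ((u₁ , u₂) , v , w) →
         let p = proj₂ b₁′≃x (u₁ , v , w)
         -- The bound by `b₂` comes from the chain b₁′ ≤ b₁ ≤ b₂.
         in p , proj₂ b₂′≃b₂ (u₂ , v , b₁≤b₂ (proj₂ (proj₂ (proj₁ b₁′≃b₁ p)))))
    where
    b₁′≃x : b₁′ ≃ a₁′ ∧ l′ ∧ x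
    b₁′≃x = T₁ x b₁≃

    admissible : ∀ {a b} → b ≤ a ∧ l → b ≃ a ∧ l ∧ b
    admissible b≤ = (λ p → let u , v = b≤ p in u , v , p) , (λ (_ , _ , p) → p)

    b₁′≃b₁ : b₁′ ≃ a₁′ ∧ l′ ∧ b₁
    b₁′≃b₁ = T₁ b₁ (admissible {a₁} {b₁} b₁≤)

    b₂′≃b₂ : b₂′ ≃ a₂′ ∧ l′ ∧ b₂
    b₂′≃b₂ = T₂ b₂ (admissible {a₂} {b₂} b₂≤)

  -- Since b₁ = a₁ ∧ a₂ ∧ l ∧ x, index 1 can serve as the least one as soon as a₁ ∧ l ∧ x ≤ a₂. The
  -- comparisons isolate the remaining case, a₂ ≤ a₁ and b₂ ≤ x.
  transfer-ordered : ∀ {a₁ b₁ a₁′ b₁′ a₂ b₂ a₂′ b₂′ x} →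
    b₁ ≤ a₁ ∧ l → b₂ ≤ a₂ ∧ l →
    Transfers l l′ a₁ b₁ a₁′ b₁′ → Transfers l l′ a₂ b₂ a₂′ b₂′ →
    b₁ ≤ b₂ → b₁ ∧ b₂ ≃ (a₁ ∧ a₂) ∧ l ∧ x →
    b₁′ ∧ b₂′ ≃ (a₁′ ∧ a₂′) ∧ l′ ∧ x
  transfer-ordered {a₁} {b₁} {a₁′} {b₁′} {a₂} {b₂} {a₂′} {b₂′} {x}
    b₁≤ b₂≤ T₁ T₂ b₁≤b₂ (f , g) =
    ≃-by-comparing a₁ a₂ {b₁′ ∧ b₂′} {(a₁′ ∧ a₂′) ∧ l′ ∧ x}
      (λ a₁≤a₂ → first λ (u , v , w) → proj₁ (g ((u , a₁≤a₂ u) , v , w)))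
      (λ a₂≤a₁ → ≃-by-comparing b₂ x {b₁′ ∧ b₂′} {(a₁′ ∧ a₂′) ∧ l′ ∧ x}
        (λ b₂≤x → second a₂≤a₁ b₂≤x)
        -- Now x ≤ b₂ ≤ a₂, so the factor `a₂` is again redundant.
        (λ x≤b₂ → first λ (u , v , w) →
          proj₁ (g ((u , proj₁ (b₂≤ (x≤b₂ w))) , v , w))))
    where
    first : a₁ ∧ l ∧ x ≤ b₁ → b₁′ ∧ b₂′ ≃ (a₁′ ∧ a₂′) ∧ l′ ∧ x
    first ≤b₁ =
      transfer-least {a₁} {b₁} {a₁′} {b₁′} {a₂} {b₂} {a₂′} {b₂′} {x}
        b₁≤ b₂≤ T₁ T₂ b₁≤b₂
        ((λ p → let (u , _) , v , w = f (p , b₁≤b₂ p) in u , v , w) , ≤b₁)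

    -- Here b₂ ≤ a₂ ∧ l ∧ x ≤ b₁ ∧ b₂, so b₁ and b₂ coincide and index 2 takes over as the least
    -- one.
    second : a₂ ≤ a₁ → b₂ ≤ x → b₁′ ∧ b₂′ ≃ (a₁′ ∧ a₂′) ∧ l′ ∧ x
    second a₂≤a₁ b₂≤x =
      ∧-swap {b₂′} {b₁′} {a₂′} {a₁′} {l′ ∧ x}
        (transfer-least {a₂} {b₂} {a₂′} {b₂′} {a₁} {b₁} {a₁′} {b₁′} {x}
          b₂≤ b₁≤ T₂ T₁
          (λ p → let u , v = b₂≤ p in proj₁ (≤b₁∧b₂ (u , v , b₂≤x p)))
          ( (λ p → let u , v = b₂≤ p in u , v , b₂≤x p)
          , (λ p → proj₂ (≤b₁∧b₂ p))))
      where
      ≤b₁∧b₂ : a₂ ∧ l ∧ x ≤ b₁ ∧ b₂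
      ≤b₁∧b₂ (u , v , w) = g ((a₂≤a₁ u , u) , v , w)

  transfer-∧ : ∀ {a₁ b₁ a₁′ b₁′ a₂ b₂ a₂′ b₂′} →
    b₁ ≤ a₁ ∧ l → b₂ ≤ a₂ ∧ l →
    Transfers l l′ a₁ b₁ a₁′ b₁′ → Transfers l l′ a₂ b₂ a₂′ b₂′ →
    Transfers l l′ (a₁ ∧ a₂) (b₁ ∧ b₂) (a₁′ ∧ a₂′) (b₁′ ∧ b₂′)
  transfer-∧ {a₁} {b₁} {a₁′} {b₁′} {a₂} {b₂} {a₂′} {b₂′} b₁≤ b₂≤ T₁ T₂ x h =
    ≃-by-comparing b₁ b₂ {b₁′ ∧ b₂′} {(a₁′ ∧ a₂′) ∧ l′ ∧ x}
      (λ b₁≤b₂ →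
        transfer-ordered {a₁} {b₁} {a₁′} {b₁′} {a₂} {b₂} {a₂′} {b₂′} {x}
          b₁≤ b₂≤ T₁ T₂ b₁≤b₂ h)
      (λ b₂≤b₁ → ∧-swap {b₂′} {b₁′} {a₂′} {a₁′} {l′ ∧ x}
        (transfer-ordered {a₂} {b₂} {a₂′} {b₂′} {a₁} {b₁} {a₁′} {b₁′} {x}
          b₂≤ b₁≤ T₂ T₁ b₂≤b₁ (∧-swap {b₁} {b₂} {a₁} {a₂} {l ∧ x} h)))

∷ʳ-≤ : {E : Set} (K : FuzzyLanguage E) (s : List E) (a : E) →
       ⟦ K ⟧ (s ∷ʳ a) ≤ ⟦ K ⟧ s
∷ʳ-≤ K s a with isLanguage K
... | inj₁ K≃0       = λ p → proj₂ (K≃0 s) (proj₁ (K≃0 (s ∷ʳ a)) p)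
... | inj₂ (_ , K↓) = K↓ s (a ∷ [])

module _ {X : Set} (A B : FuzzySubset X) {x : X} where

  supp-∩ˡ : x ∈supp A ∩ B → x ∈supp A
  supp-∩ˡ = map₂ (map₂ proj₁)

  supp-∩ʳ : x ∈supp A ∩ B → x ∈supp B
  supp-∩ʳ = map₂ (map₂ proj₂)

module _ {n : ℕ} (𝓛 : FuzzyLanguage (Fin n)) (Eₒ E_c : Subset n)
         (K₁ K₂ : FuzzyLanguage (Fin n)) where

  private
    A₁ = ⟦ K₁ ⟧
    A₂ = ⟦ K₂ ⟧
    Λ  = ⟦ 𝓛 ⟧

    left : ∀ {s} → s ∈supp A₁ ∩ A₂ → s ∈supp A₁
    left {s} = supp-∩ˡ A₁ A₂ {s}

    right : ∀ {s} → s ∈supp A₁ ∩ A₂ → s ∈supp A₂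
    right {s} = supp-∩ʳ A₁ A₂ {s}

  observable-∩ : Observable 𝓛 Eₒ E_c K₁ → Observable 𝓛 Eₒ E_c K₂ →
                 Observable 𝓛 Eₒ E_c (K₁ ∩ᴸ K₂)
  observable-∩ O₁ O₂ s s′ s∈ s′∈ Ps≡Ps′ a a∈ sa∈
    with O₁ s s′ (left {s} s∈) (left {s′} s′∈) Ps≡Ps′ a a∈ (left {s ∷ʳ a} sa∈)
       | O₂ s s′ (right {s} s∈) (right {s′} s′∈) Ps≡Ps′ a a∈ (right {s ∷ʳ a} sa∈)
  ... | x₁ , e₁ , e₁′ | x₂ , e₂ , e₂′ = x₁ ∧ x₂ , factor s e₁ e₂ , factor s′ e₁′ e₂′
    where
    factor : ∀ t → A₁ (t ∷ʳ a) ≃ A₁ t ∧ Λ (t ∷ʳ a) ∧ x₁ →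
             A₂ (t ∷ʳ a) ≃ A₂ t ∧ Λ (t ∷ʳ a) ∧ x₂ →
             (A₁ ∩ A₂) (t ∷ʳ a) ≃ (A₁ ∩ A₂) t ∧ Λ (t ∷ʳ a) ∧ (x₁ ∧ x₂)
    factor t = ∧-factor {A₁ (t ∷ʳ a)} {A₂ (t ∷ʳ a)} {A₁ t} {A₂ t} {Λ (t ∷ʳ a)} {x₁} {x₂}

  stronglyObservable-∩ : A₁ ⊆ Λ → A₂ ⊆ Λ →
    StronglyObservable 𝓛 Eₒ E_c K₁ → StronglyObservable 𝓛 Eₒ E_c K₂ →
    StronglyObservable 𝓛 Eₒ E_c (K₁ ∩ᴸ K₂)
  stronglyObservable-∩ A₁⊆Λ A₂⊆Λ S₁ S₂ s s′ s∈ s′∈ Ps≡Ps′ a a∈ sa∈ =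
    transfer-∧ {Λ (s ∷ʳ a)} {Λ (s′ ∷ʳ a)}
      {A₁ s} {A₁ (s ∷ʳ a)} {A₁ s′} {A₁ (s′ ∷ʳ a)}
      {A₂ s} {A₂ (s ∷ʳ a)} {A₂ s′} {A₂ (s′ ∷ʳ a)}
      -- Prefix monotonicity and inclusion in `Λ` bound Kᵢ(sa) by Kᵢ(s) ∧ 𝓛(sa), so that Kᵢ(sa) is
      -- itself an admissible value.
      (λ p → ∷ʳ-≤ K₁ s a p , A₁⊆Λ (s ∷ʳ a) p)
      (λ p → ∷ʳ-≤ K₂ s a p , A₂⊆Λ (s ∷ʳ a) p)
      (S₁ s s′ (left {s} s∈) (left {s′} s′∈) Ps≡Ps′ a a∈ (left {s ∷ʳ a} sa∈))
      (S₂ s s′ (right {s} s∈) (right {s′} s′∈) Ps≡Ps′ a a∈ (right {s ∷ʳ a} sa∈))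

proposition3 : ∀ (n : ℕ) (𝓛 : FuzzyLanguage (Fin n)) (Eₒ E_c : Subset n)
    (K₁ K₂ : FuzzyLanguage (Fin n)) →
    ⟦ K₁ ⟧ ⊆ ⟦ 𝓛 ⟧ → ⟦ K₂ ⟧ ⊆ ⟦ 𝓛 ⟧ →
    (Observable 𝓛 Eₒ E_c K₁ → Observable 𝓛 Eₒ E_c K₂ →
    Observable 𝓛 Eₒ E_c (K₁ ∩ᴸ K₂))
    × (StronglyObservable 𝓛 Eₒ E_c K₁ → StronglyObservable 𝓛 Eₒ E_c K₂ →
    StronglyObservable 𝓛 Eₒ E_c (K₁ ∩ᴸ K₂))
proposition3 n 𝓛 Eₒ E_c K₁ K₂ K₁⊆𝓛 K₂⊆𝓛 =
    observable-∩ 𝓛 Eₒ E_c K₁ K₂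
  , stronglyObservable-∩ 𝓛 Eₒ E_c K₁ K₂ K₁⊆𝓛 K₂⊆𝓛
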